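{- Let $n\ge 4$ be an integer and let $K(n,2)$ be the Kneser graph whose vertices are the $2$-element subsets of $[n]=\{1,\ldots,n\}$, two vertices being adjacent if and only if they are disjoint. Then \[ \mathrm{gp}(K(n,2)) = \begin{cases} 6, & 4\le n\le 6,\\ n-1, & n\ge 7. \end{cases} \]
   Context: Graphs are finite, undirected and simple. For a graph $G$, $d_G$ is the shortest-path distance; a $u,v$-geodesic is a $u,v$-path of length $d_G(u,v)$ (vertices in different connected components are joined by no geodesic). A set $S\subseteq V(G)$ is a general position set of $G$ if no vertex of $S$ lies on a geodesic between two other vertices of $S$; that is, for no three pairwise different $u,v,w\in S$ lying in one connected component does $d_G(u,v)=d_G(u,w)+d_G(w,v)$ hold. The general position number $\mathrm{gp}(G)$ is the maximum cardinality of a general position set of $G$. -}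

module Defs where

open import Data.Fin.Subset using (Subset; inside; outside; _∩_; ∣_∣; Empty)
open import Data.Fin.Subset.Properties using (∩-comm; ∩-idem; Empty-unique; ∣⊥∣≡0)
open import Data.List using (List; []; _∷_; _++_; map; length)
open import Data.List.Membership.Propositional using (_∈_; _∉_)
open import Data.List.Membership.Propositional.Properties using (∈-map⁺; ∈-++⁺ˡ; ∈-++⁺ʳ)
open import Data.List.Relation.Unary.Any using (here)
open import Data.List.Relation.Unary.Enumerates.Setoid using (IsEnumeration)
open import Data.List.Relation.Unary.Unique.Propositional using (Unique)
open import Data.Nat using (ℕ; zero; suc; _≤_)
open import Data.Product using (Σ; ∃-syntax; _×_; _,_; proj₁)
open import Data.Vec using ([]; _∷_)
open import Relation.Binary.Construct.Closure.ReflexiveTransitive using (Star; ε; _◅_)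
open import Relation.Binary.Definitions using (Symmetric)
open import Relation.Binary.PropositionalEquality using (_≡_; _≢_; refl; sym; trans; cong; subst; setoid)
open import Relation.Nullary using (¬_)

record Graph : Set₁ where
  infix 4 _~_
  field
    V      : Set
    _~_    : V → V → Set
    ~-sym  : Symmetric _~_
    ~-irr  : ∀ v → ¬ (v ~ v)
    finite : ∃[ xs ] IsEnumeration (setoid V) xs

module _ (G : Graph) where
  open Graph G

  Walk : V → V → Set
  Walk = Star _~_

  walkLength : ∀ {u v} → Walk u v → ℕ
  walkLength ε       = 0
  walkLength (_ ◅ p) = suc (walkLength p)

  vertices : ∀ {u v} → Walk u v → List V
  vertices {u} ε       = u ∷ []
  vertices {u} (_ ◅ p) = u ∷ vertices p

  IsPath : ∀ {u v} → Walk u v → Set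
  IsPath p = Unique (vertices p)

  -- d(u , v) = k, as a relation because the distance is undefined for
  -- vertices in different components.
  IsDistance : V → V → ℕ → Set
  IsDistance u v k =
    (∃[ p ] IsPath {u} {v} p × walkLength p ≡ k)
    × (∀ (q : Walk u v) → IsPath q → k ≤ walkLength q)

  IsGeodesic : ∀ {u v} → Walk u v → Set
  IsGeodesic {u} {v} p = IsPath p × IsDistance u v (walkLength p)

  -- Finite vertex sets are duplicate-free lists, with `length` as cardinality.
  IsGeneralPosition : List V → Set
  IsGeneralPosition S =
    Unique S
    × (∀ {u v w} → u ∈ S → v ∈ S → w ∈ S → u ≢ v → u ≢ w → v ≢ w →
       (p : Walk u v) → IsGeodesic p → w ∉ vertices p)

  -- gp(G) = k.
  IsGpNumber : ℕ → Set
  IsGpNumber k =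
    (∃[ S ] IsGeneralPosition S × length S ≡ k)
    × (∀ S → IsGeneralPosition S → length S ≤ k)

-- Proofs of ∣ p ∣ ≡ k are unique, so _≡_ on this type is equality of subsets.
SubsetOfSize : ℕ → ℕ → Set
SubsetOfSize n k = Σ (Subset n) λ p → ∣ p ∣ ≡ k

private
  consIn : ∀ {n k} → SubsetOfSize n k → SubsetOfSize (suc n) (suc k)
  consIn (p , e) = inside ∷ p , cong suc e

  consOut : ∀ {n k} → SubsetOfSize n k → SubsetOfSize (suc n) k
  consOut (p , e) = outside ∷ p , e

subsetsOfSize : ∀ n k → List (SubsetOfSize n k)
subsetsOfSize zero    zero    = ([] , refl) ∷ []
subsetsOfSize zero    (suc k) = []
subsetsOfSize (suc n) zero    = map consOut (subsetsOfSize n zero)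
subsetsOfSize (suc n) (suc k) =
  map consIn (subsetsOfSize n k) ++ map consOut (subsetsOfSize n (suc k))

subsetsOfSize-complete : ∀ n k → IsEnumeration (setoid (SubsetOfSize n k)) (subsetsOfSize n k)
subsetsOfSize-complete zero    .0 ([] , refl) = here refl
subsetsOfSize-complete (suc n) .(suc ∣ p ∣) (inside ∷ p , refl) =
  ∈-++⁺ˡ (∈-map⁺ consIn (subsetsOfSize-complete n ∣ p ∣ (p , refl)))
subsetsOfSize-complete (suc n) zero    (outside ∷ p , e) =
  ∈-map⁺ consOut (subsetsOfSize-complete n zero (p , e))
subsetsOfSize-complete (suc n) (suc k) (outside ∷ p , e) =
  ∈-++⁺ʳ (map consIn (subsetsOfSize n k))
         (∈-map⁺ consOut (subsetsOfSize-complete n (suc k) (p , e)))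

-- The Kneser graph K(n,2), with Fin n in place of {1,…,n}.
K₂ : ℕ → Graph
K₂ n = record
  { V      = SubsetOfSize n 2
  ; _~_    = λ (p , _) (q , _) → Empty (p ∩ q)
  ; ~-sym  = λ {(p , _)} {(q , _)} → subst Empty (∩-comm p q)
  ; ~-irr  = irr
  ; finite = subsetsOfSize n 2 , subsetsOfSize-complete n 2
  }
  where
  irr : (v : SubsetOfSize n 2) → ¬ Empty (proj₁ v ∩ proj₁ v)
  irr (p , e) emp
    with trans (sym e) (trans (cong ∣_∣ (Empty-unique (subst Empty (∩-idem p) emp))) (∣⊥∣≡0 n))
  ... | ()

{-# OPTIONS --safe #-}
module Submission where

-- Two disjoint vertices of K(n,2) have distance 1, and two distinct
-- intersecting ones have distance 2 as soon as some vertex is disjoint from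
-- both.  So, reading vertices as edges on [n], a general position set
-- contains no two edges sharing an end together with a third edge disjoint
-- from both.  Such an edge set is either a matching, or has an incident pair
-- ab, ac and then every edge meets {a,b,c}: if a, b, c all have degree at
-- most 2 there are at most 6 edges, and if some vertex has three edges, either
-- all edges pass through it (at most n - 1) or all lie in one K4 (at most 6).
-- Conversely a star is in general position for n ≥ 5, because then the
-- diameter is 2.  So are the edges of a K4: two of them disjoint from a third
-- coincide.  For n = 4 the graph is a perfect matching and all 6 vertices do.

open import Defs
open import Data.Bool.Properties using () renaming (_≟_ to _≟ᵇ_)
open import Data.Fin using (Fin; zero; suc; punchIn; punchOut)
open import Data.Fin.Properties using (punchIn-punchOut)
open import Data.Fin.Subset
  using (Subset; inside; outside; _∩_; _∪_; ∁; ⁅_⁆; ⋃; ∣_∣; Empty; Nonempty)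
  renaming (_∈_ to _∈ˢ_; _∉_ to _∉ˢ_; _⊆_ to _⊆ˢ_; ⊥ to ∅)
open import Data.Fin.Subset.Properties
  using (_∈?_; nonempty?; ∉⊥; ∣p∣≤n; ∣⊥∣≡0; Empty-unique; x∈⁅x⁆; x∈⁅y⁆⇒x≡y; x∈p∩q⁺; x∈p∩q⁻;
         x∈p∪q⁺; x∈p∪q⁻; ∪-comm; ∪-identityˡ; ∩-comm; ⊥⊆; s⊆s; x∈p⇒∣p-x∣<∣p∣; ∣∁p∣≡n∸∣p∣;
         x∈∁p⇒x∉p; ∣⁅x⁆∣≡1; drop-∷-Empty)
open import Data.List using (List; []; _∷_; length; map; filter; tabulate)
open import Data.List.Properties using (filter-all; filter-notAll; length-map; length-tabulate)
open import Data.List.Membership.Propositional using (_∈_; _∉_; find)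
open import Data.List.Membership.Propositional.Properties
  using (∈-filter⁺; ∈-filter⁻; ∈-tabulate⁺; ∈-tabulate⁻; ∈-map⁻)
open import Data.List.Relation.Binary.Subset.Propositional using (_⊆_)
open import Data.List.Relation.Unary.All as All using (All; []; _∷_)
open import Data.List.Relation.Unary.All.Properties using (¬All⇒Any¬)
open import Data.List.Relation.Unary.AllPairs using (AllPairs; []; _∷_)
open import Data.List.Relation.Unary.Any as Any using (here; there)
open import Data.List.Relation.Unary.Unique.DecPropositional using (unique?)
open import Data.List.Relation.Unary.Unique.Propositional using (Unique)
import Data.List.Relation.Unary.Unique.Propositional.Properties as Unique
open import Data.Nat using (ℕ; zero; suc; _+_; _*_; _∸_; _≤_; _<_; z≤n; s≤s; _≤?_)
open import Data.Nat.Properties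
open import Data.Product using (∃-syntax; Σ-syntax; _×_; _,_; proj₁; proj₂)
open import Data.Sum using (_⊎_; inj₁; inj₂; [_,_]′) renaming (map to map-⊎; map₂ to map₂-⊎)
open import Data.Vec using ([]; _∷_; here; there)
open import Data.Vec.Properties using (≡-dec; ∷-injectiveʳ)
open import Function using (_∘_; id; case_of_)
open import Level using (Level)
open import Relation.Binary.Construct.Closure.ReflexiveTransitive using (ε; _◅_)
open import Relation.Binary.Definitions using (DecidableEquality)
open import Relation.Binary.PropositionalEquality
  using (_≡_; _≢_; refl; sym; trans; cong; cong₂; subst; ≢-sym)
open import Relation.Nullary using (from-yes; ¬_; yes; no; contradiction; ¬?; decidable-stable)
open import Relation.Unary using (Pred; Decidable)
open import Relation.Unary.Properties using (_∪?_)

private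
  variable
    ℓ : Level
    A : Set ℓ
    m n : ℕ
    x y z : Fin n
    p q : Subset n

-- Counting in lists and finite subsets.

_≟ˢ_ : DecidableEquality (Subset n)
_≟ˢ_ = ≡-dec _≟ᵇ_

-- Pigeonhole: deleting `x` from `ys` makes it strictly shorter and keeps all of `xs`, where `x`
-- does not recur.
unique⊆⇒length≤ : DecidableEquality A → {xs ys : List A} →
                  Unique xs → xs ⊆ ys → length xs ≤ length ys
unique⊆⇒length≤ _≟_ {[]}     _          _     = z≤n
unique⊆⇒length≤ _≟_ {x ∷ xs} {ys} (x# ∷ xs!) xs⊆ys = ≤-trans
  (s≤s (unique⊆⇒length≤ _≟_ xs! λ {z} z∈xs →
    ∈-filter⁺ (¬? ∘ (x ≟_)) (xs⊆ys (there z∈xs)) (All.lookup x# z∈xs)))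
  (filter-notAll (¬? ∘ (x ≟_)) ys (Any.map (λ x≡y x≢y → x≢y x≡y) (xs⊆ys (here refl))))

length-filter-∪ : {P Q : Pred A ℓ} (P? : Decidable P) (Q? : Decidable Q) (xs : List A) →
  length (filter (P? ∪? Q?) xs) ≤ length (filter P? xs) + length (filter Q? xs)
length-filter-∪ P? Q? [] = z≤n
length-filter-∪ P? Q? (x ∷ xs) with length-filter-∪ P? Q? xs | P? x | Q? x
... | ih | yes _ | yes _ = s≤s (≤-trans ih (+-monoʳ-≤ (length (filter P? xs)) (n≤1+n _)))
... | ih | yes _ | no _  = s≤s ih
... | ih | no _  | yes _ = ≤-trans (s≤s ih) (≤-reflexive (sym (+-suc _ _)))
... | ih | no _  | no _  = ih

∣p∪q∣+∣p∩q∣ : (p q : Subset n) → ∣ p ∪ q ∣ + ∣ p ∩ q ∣ ≡ ∣ p ∣ + ∣ q ∣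
∣p∪q∣+∣p∩q∣ []            []            = refl
∣p∪q∣+∣p∩q∣ (outside ∷ p) (outside ∷ q) = ∣p∪q∣+∣p∩q∣ p q
∣p∪q∣+∣p∩q∣ (outside ∷ p) (inside ∷ q)  = trans (cong suc (∣p∪q∣+∣p∩q∣ p q)) (sym (+-suc _ _))
∣p∪q∣+∣p∩q∣ (inside ∷ p)  (outside ∷ q) = cong suc (∣p∪q∣+∣p∩q∣ p q)
∣p∪q∣+∣p∩q∣ (inside ∷ p)  (inside ∷ q)  = cong suc
  (trans (+-suc _ _) (trans (cong suc (∣p∪q∣+∣p∩q∣ p q)) (sym (+-suc _ _))))

∣p∣≡0⇒p≡∅ : (p : Subset n) → ∣ p ∣ ≡ 0 → p ≡ ∅
∣p∣≡0⇒p≡∅ []            _ = refl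
∣p∣≡0⇒p≡∅ (outside ∷ p) e = cong (outside ∷_) (∣p∣≡0⇒p≡∅ p e)

∣p∣≡1⇒p≡⁅x⁆ : (p : Subset n) → ∣ p ∣ ≡ 1 → ∃[ x ] p ≡ ⁅ x ⁆
∣p∣≡1⇒p≡⁅x⁆ (inside ∷ p)  e = zero , cong (inside ∷_) (∣p∣≡0⇒p≡∅ p (suc-injective e))
∣p∣≡1⇒p≡⁅x⁆ (outside ∷ p) e with x , refl ← ∣p∣≡1⇒p≡⁅x⁆ p e = suc x , refl

disjoint⇒∣p∪q∣≡∣p∣+∣q∣ : (p q : Subset n) → Empty (p ∩ q) → ∣ p ∪ q ∣ ≡ ∣ p ∣ + ∣ q ∣
disjoint⇒∣p∪q∣≡∣p∣+∣q∣ {n} p q p#q = trans (sym (+-identityʳ _)) (trans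
  (cong (∣ p ∪ q ∣ +_) (sym (trans (cong ∣_∣ (Empty-unique p#q)) (∣⊥∣≡0 n))))
  (∣p∪q∣+∣p∩q∣ p q))

-- Two-element subsets as edges.

edge : Fin n → Fin n → Subset n
edge x y = ⁅ x ⁆ ∪ ⁅ y ⁆

∈-edgeˡ : (x y : Fin n) → x ∈ˢ edge x y
∈-edgeˡ x y = x∈p∪q⁺ (inj₁ (x∈⁅x⁆ x))

∈-edge⁻ : z ∈ˢ edge x y → z ≡ x ⊎ z ≡ y
∈-edge⁻ {x = x} {y} z∈ with x∈p∪q⁻ ⁅ x ⁆ ⁅ y ⁆ z∈
... | inj₁ z∈x = inj₁ (x∈⁅y⁆⇒x≡y x z∈x)
... | inj₂ z∈y = inj₂ (x∈⁅y⁆⇒x≡y y z∈y)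

otherEnd : ∣ p ∣ ≡ 2 → x ∈ˢ p → ∃[ y ] x ≢ y × p ≡ edge x y
otherEnd {p = inside ∷ p} e here
  with y , refl ← ∣p∣≡1⇒p≡⁅x⁆ p (suc-injective e) =
  suc y , (λ ()) , cong (inside ∷_) (sym (∪-identityˡ _))
otherEnd {p = inside ∷ p} e (there x∈p)
  with y , refl ← ∣p∣≡1⇒p≡⁅x⁆ p (suc-injective e)
  with refl ← x∈⁅y⁆⇒x≡y y x∈p =
  zero , (λ ()) , cong (inside ∷_) (sym (trans (∪-comm _ _) (∪-identityˡ _)))
otherEnd {p = outside ∷ p} e (there x∈p) with otherEnd e x∈p
... | y , x≢y , refl = suc y , (λ { refl → x≢y refl }) , refl

bothEnds : ∣ p ∣ ≡ 2 → x ∈ˢ p → y ∈ˢ p → x ≢ y → p ≡ edge x y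
bothEnds e x∈p y∈p x≢y with otherEnd e x∈p
... | z , _ , refl with ∈-edge⁻ y∈p
...   | inj₁ refl = contradiction refl x≢y
...   | inj₂ refl = refl

edgesAmong : (a b c d : Fin n) → List (Subset n)
edgesAmong a b c d = edge a b ∷ edge a c ∷ edge a d ∷ edge b c ∷ edge b d ∷ edge c d ∷ []

-- `punchIn a` runs through the other `m` points, so the list has the length `m` that yields the
-- bound n - 1.
edgesAt : Fin (suc m) → List (Subset (suc m))
edgesAt a = tabulate λ i → edge a (punchIn a i)

∈-edgesAt : {a : Fin (suc m)} → ∣ p ∣ ≡ 2 → a ∈ˢ p → p ∈ edgesAt a
∈-edgesAt {a = a} e a∈p with otherEnd e a∈p
... | y , a≢y , refl = subst (λ z → edge a z ∈ edgesAt a) (punchIn-punchOut a≢y)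
                         (∈-tabulate⁺ (punchOut a≢y))

-- Matchings and incident pairs.

matching⊎cherry : (S : List (Subset n)) → Unique S →
  AllPairs (λ p q → Empty (p ∩ q)) S ⊎
  (∃[ p ] ∃[ q ] p ∈ S × q ∈ S × p ≢ q × Nonempty (p ∩ q))
matching⊎cherry []      _        = inj₁ []
matching⊎cherry (p ∷ S) (p# ∷ S!) with All.all? (λ q → ¬? (nonempty? (p ∩ q))) S | matching⊎cherry S S!
... | yes p∩S | inj₁ S∩S = inj₁ (p∩S ∷ S∩S)
... | _       | inj₂ (q , r , q∈S , r∈S , q≢r , q∩r) =
  inj₂ (q , r , there q∈S , there r∈S , q≢r , q∩r)
... | no ¬p∩S | inj₁ _
  with q , q∈S , ¬¬p∩q ← find (¬All⇒Any¬ (λ q → ¬? (nonempty? (p ∩ q))) S ¬p∩S) =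
  inj₂ (p , q , here refl , there q∈S , All.lookup p# q∈S , decidable-stable (nonempty? _) ¬¬p∩q)

⋃-disjoint : (p : Subset n) {S : List (Subset n)} → All (λ q → Empty (p ∩ q)) S → Empty (p ∩ ⋃ S)
⋃-disjoint p []  (x , x∈) = contradiction (proj₂ (x∈p∩q⁻ p ∅ x∈)) ∉⊥
⋃-disjoint p {q ∷ S} (p#q ∷ p#S) (x , x∈) with x∈p∩q⁻ p _ x∈
... | x∈p , x∈qS with x∈p∪q⁻ q (⋃ S) x∈qS
...   | inj₁ x∈q = p#q (x , x∈p∩q⁺ (x∈p , x∈q))
...   | inj₂ x∈S = ⋃-disjoint p p#S (x , x∈p∩q⁺ (x∈p , x∈S))

matching⇒∣⋃∣ : {S : List (Subset n)} → All (λ p → ∣ p ∣ ≡ 2) S →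
  AllPairs (λ p q → Empty (p ∩ q)) S → ∣ ⋃ S ∣ ≡ length S * 2
matching⇒∣⋃∣ {n} []  []         = ∣⊥∣≡0 n
matching⇒∣⋃∣ {S = p ∷ S} (e ∷ es) (p# ∷ S#) =
  trans (disjoint⇒∣p∪q∣≡∣p∣+∣q∣ p (⋃ S) (⋃-disjoint p p#)) (cong₂ _+_ e (matching⇒∣⋃∣ es S#))

-- Upper bound for families of edges.

module UpperBound
  (S    : List (Subset n))
  (S!   : Unique S)
  (size : ∀ {p} → p ∈ S → ∣ p ∣ ≡ 2)
  (free : ∀ {u v w} → u ∈ S → v ∈ S → w ∈ S → u ≢ v → Nonempty (u ∩ v) →
          Nonempty (u ∩ w) ⊎ Nonempty (v ∩ w))
  where

  degree : Fin n → ℕ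
  degree x = length (filter (x ∈?_) S)

  matching-bound : AllPairs (λ p q → Empty (p ∩ q)) S → length S * 2 ≤ n
  matching-bound S# = subst (_≤ n) (matching⇒∣⋃∣ (All.tabulate size) S#) (∣p∣≤n (⋃ S))

  star-bound : ∀ a → All (a ∈ˢ_) S → length S < n
  star-bound = go n S S! size
    where
    -- The ends other than a are enumerated by punchIn, so n must become a successor.
    go : ∀ n (S : List (Subset n)) → Unique S → (∀ {p} → p ∈ S → ∣ p ∣ ≡ 2) →
         ∀ a → All (a ∈ˢ_) S → length S < n
    go (suc m) S S! size a a∈S = s≤s (subst (length S ≤_) (length-tabulate _)
      (unique⊆⇒length≤ _≟ˢ_ S! λ p∈S → ∈-edgesAt (size p∈S) (All.lookup a∈S p∈S)))

  -- As `w` avoids the shared end `a`, it can meet either edge only at the other end.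
  hits : ∀ {a x y w} → edge a x ∈ S → edge a y ∈ S → edge a x ≢ edge a y → w ∈ S → a ∉ˢ w →
         x ∈ˢ w ⊎ y ∈ˢ w
  hits {a} {x} {y} {w} ax ay ax≢ay w∈S a∉w =
    map-⊎ end∈w end∈w (free ax ay w∈S ax≢ay (a , x∈p∩q⁺ (∈-edgeˡ a x , ∈-edgeˡ a y)))
    where
    end∈w : ∀ {z} → Nonempty (edge a z ∩ w) → z ∈ˢ w
    end∈w {z} (t , t∈) with t∈az , t∈w ← x∈p∩q⁻ (edge a z) w t∈ with ∈-edge⁻ t∈az
    ... | inj₁ refl = contradiction t∈w a∉w
    ... | inj₂ refl = t∈w

  module _ {a b c d w} (ab : edge a b ∈ S) (ac : edge a c ∈ S) (ad : edge a d ∈ S)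
           (ab≢ac : edge a b ≢ edge a c) (ab≢ad : edge a b ≢ edge a d) (ac≢ad : edge a c ≢ edge a d)
           (w∈S : w ∈ S) (a∉w : a ∉ˢ w) where

    -- By `hits`, `f` meets each two of `b`, `c`, `d`, so it contains two of these points and,
    -- having size two, nothing else.
    opposite : ∀ {f} → f ∈ S → a ∉ˢ f → f ≡ edge b c ⊎ f ≡ edge b d ⊎ f ≡ edge c d
    opposite f∈S a∉f with hits ab ac ab≢ac f∈S a∉f | hits ab ad ab≢ad f∈S a∉f | hits ac ad ac≢ad f∈S a∉f
    ... | inj₁ b∈f | _        | inj₁ c∈f = inj₁ (bothEnds (size f∈S) b∈f c∈f λ { refl → ab≢ac refl })
    ... | inj₁ b∈f | _        | inj₂ d∈f = inj₂ (inj₁ (bothEnds (size f∈S) b∈f d∈f λ { refl → ab≢ad refl }))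
    ... | inj₂ c∈f | inj₁ b∈f | _        = inj₁ (bothEnds (size f∈S) b∈f c∈f λ { refl → ab≢ac refl })
    ... | inj₂ c∈f | inj₂ d∈f | _        = inj₂ (inj₂ (bothEnds (size f∈S) c∈f d∈f λ { refl → ac≢ad refl }))

    ¬bcd⊆w : ¬ (b ∈ˢ w × c ∈ˢ w × d ∈ˢ w)
    ¬bcd⊆w (b∈w , c∈w , d∈w) with refl ← bothEnds (size w∈S) b∈w c∈w (λ { refl → ab≢ac refl }) | ∈-edge⁻ d∈w
    ... | inj₁ refl = ab≢ad refl
    ... | inj₂ refl = ac≢ad refl

    inTriangle : ∀ {x} → x ∈ˢ w → x ≡ b ⊎ x ≡ c ⊎ x ≡ d
    inTriangle x∈w with opposite w∈S a∉w
    ... | inj₁ refl        = map₂-⊎ inj₁ (∈-edge⁻ x∈w)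
    ... | inj₂ (inj₁ refl) = map₂-⊎ inj₂ (∈-edge⁻ x∈w)
    ... | inj₂ (inj₂ refl) = inj₂ (∈-edge⁻ x∈w)

    spoke : ∀ {x} → x ∈ˢ w → edge a x ≡ edge a b ⊎ edge a x ≡ edge a c ⊎ edge a x ≡ edge a d
    spoke = map-⊎ (cong (edge a)) (map-⊎ (cong (edge a)) (cong (edge a))) ∘ inTriangle

    -- Pair a supposed fourth spoke `edge a x` with each known one: every time `w` contains `x` or
    -- the outer end of the known spoke. It cannot contain all of `b`, `c`, `d`, so it contains `x`;
    -- but `w` is itself a side of that triangle.
    through : ∀ {x} → edge a x ∈ S →
              edge a x ≡ edge a b ⊎ edge a x ≡ edge a c ⊎ edge a x ≡ edge a d
    through {x} ax with edge a x ≟ˢ edge a b | edge a x ≟ˢ edge a c | edge a x ≟ˢ edge a d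
    ... | yes e | _     | _     = inj₁ e
    ... | no _  | yes e | _     = inj₂ (inj₁ e)
    ... | no _  | no _  | yes e = inj₂ (inj₂ e)
    ... | no ≢b | no ≢c | no ≢d
      with hits ax ab ≢b w∈S a∉w | hits ax ac ≢c w∈S a∉w | hits ax ad ≢d w∈S a∉w
    ...   | inj₂ b∈w | inj₂ c∈w | inj₂ d∈w = contradiction (b∈w , c∈w , d∈w) ¬bcd⊆w
    ...   | inj₁ x∈w | _        | _        = spoke x∈w
    ...   | inj₂ _   | inj₁ x∈w | _        = spoke x∈w
    ...   | inj₂ _   | inj₂ _   | inj₁ x∈w = spoke x∈w

    S⊆edgesAmong : S ⊆ edgesAmong a b c d
    S⊆edgesAmong {f} f∈S with a ∈? f
    ... | yes a∈f with otherEnd (size f∈S) a∈f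
    ...   | x , _ , refl with through f∈S
    ...     | inj₁ e        = here e
    ...     | inj₂ (inj₁ e) = there (here e)
    ...     | inj₂ (inj₂ e) = there (there (here e))
    S⊆edgesAmong f∈S | no a∉f with opposite f∈S a∉f
    ...     | inj₁ e        = there (there (there (here e)))
    ...     | inj₂ (inj₁ e) = there (there (there (there (here e))))
    ...     | inj₂ (inj₂ e) = there (there (there (there (there (here e)))))

  claw-bound : ∀ a → 3 ≤ degree a → length S ≤ 6 ⊎ length S < n
  claw-bound a 3≤deg with All.all? (a ∈?_) S
  ... | yes a∈S = inj₂ (star-bound a a∈S)
  -- The filtered list is abstracted together with its uniqueness proof, so that its first three
  -- entries come out pairwise distinct.
  ... | no ¬a∈S with find (¬All⇒Any¬ (a ∈?_) S ¬a∈S) | filter (a ∈?_) S in eq | Unique.filter⁺ (a ∈?_) S!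
  ...   | w , w∈S , a∉w | e ∷ f ∷ g ∷ _ | (e≢f ∷ e≢g ∷ _) ∷ (f≢g ∷ _) ∷ _
    with e∈S , a∈e ← ∈-filter⁻ (a ∈?_) {xs = S} (subst (e ∈_) (sym eq) (here refl))
       | f∈S , a∈f ← ∈-filter⁻ (a ∈?_) {xs = S} (subst (f ∈_) (sym eq) (there (here refl)))
       | g∈S , a∈g ← ∈-filter⁻ (a ∈?_) {xs = S} (subst (g ∈_) (sym eq) (there (there (here refl))))
    with otherEnd (size e∈S) a∈e | otherEnd (size f∈S) a∈f | otherEnd (size g∈S) a∈g
  ...   | b , _ , refl | c , _ , refl | d , _ , refl =
    inj₁ (unique⊆⇒length≤ _≟ˢ_ S! (S⊆edgesAmong e∈S f∈S g∈S e≢f e≢g f≢g w∈S a∉w))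
  claw-bound a (s≤s ()) | no _ | _ | _ ∷ [] | _
  claw-bound a (s≤s (s≤s ())) | no _ | _ | _ ∷ _ ∷ [] | _

  -- By `hits` every member of `S` contains `a`, `b` or `c`, so the three degrees sum to at least
  -- `length S`; a degree of 3 or more is left to `claw-bound`.
  cherry-bound : ∀ a b c → edge a b ∈ S → edge a c ∈ S → edge a b ≢ edge a c → length S ≤ 6 ⊎ length S < n
  cherry-bound a b c ab ac ab≢ac with 3 ≤? degree a | 3 ≤? degree b | 3 ≤? degree c
  ... | yes 3≤ | _      | _      = claw-bound a 3≤
  ... | no _   | yes 3≤ | _      = claw-bound b 3≤
  ... | no _   | no _   | yes 3≤ = claw-bound c 3≤
  ... | no a≱3 | no b≱3 | no c≱3 = inj₁ (begin
    length S                               ≡⟨ cong length (filter-all any? (All.tabulate meets)) ⟨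
    length (filter any? S)                 ≤⟨ length-filter-∪ (a ∈?_) _ S ⟩
    degree a + length (filter b∪c? S)      ≤⟨ +-monoʳ-≤ (degree a) (length-filter-∪ (b ∈?_) _ S) ⟩
    degree a + (degree b + degree c)       ≤⟨ +-mono-≤ (≤2 a≱3) (+-mono-≤ (≤2 b≱3) (≤2 c≱3)) ⟩
    6                                      ∎)
    where
    open ≤-Reasoning
    ≤2 : ∀ {k} → ¬ (3 ≤ k) → k ≤ 2
    ≤2 k≱3 = ≤-pred (≰⇒> k≱3)
    b∪c? = (b ∈?_) ∪? (c ∈?_)
    any? = (a ∈?_) ∪? b∪c?
    meets : ∀ {p} → p ∈ S → a ∈ˢ p ⊎ (b ∈ˢ p ⊎ c ∈ˢ p)
    meets {p} p∈S with a ∈? p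
    ... | yes a∈p = inj₁ a∈p
    ... | no a∉p = inj₂ (hits ab ac ab≢ac p∈S a∉p)

  bound : length S ≤ 6 ⊎ length S < n
  bound with matching⊎cherry S S!
  ... | inj₂ (p , q , p∈S , q∈S , p≢q , a , a∈p∩q)
    with a∈p , a∈q ← x∈p∩q⁻ p q a∈p∩q
    with b , _ , refl ← otherEnd (size p∈S) a∈p | c , _ , refl ← otherEnd (size q∈S) a∈q =
    cherry-bound a b c p∈S q∈S p≢q
  -- A matching of `k + 1` edges has `2k + 2 ≤ n`, whence `k + 2 ≤ n`. The empty one goes left
  -- because `n` may be 0.
  ... | inj₁ S# with length S | matching-bound S#
  ...   | zero  | _   = inj₁ z≤n
  ...   | suc k | 2k≤n = inj₂ (≤-trans (s≤s (s≤s (m≤m*n k 2))) 2k≤n)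

-- Geodesics of length two in an arbitrary graph.

module _ (G : Graph) where
  open Graph G

  end∈vertices : ∀ {u v} (p : Walk G u v) → v ∈ vertices G p
  end∈vertices ε       = here refl
  end∈vertices (_ ◅ p) = there (end∈vertices p)

  ~⇒≢ : ∀ {u v} → u ~ v → u ≢ v
  ~⇒≢ u~v refl = ~-irr _ u~v

  edge-isPath : ∀ {u v} (e : u ~ v) → IsPath G (e ◅ ε)
  edge-isPath e = (~⇒≢ e ∷ []) ∷ [] ∷ []

  cherry-isPath : ∀ {u v x} (e : u ~ x) (f : x ~ v) → u ≢ v → IsPath G (e ◅ f ◅ ε)
  cherry-isPath e f u≢v = (~⇒≢ e ∷ u≢v ∷ []) ∷ edge-isPath f

  cherry-isGeodesic : ∀ {u v x} (e : u ~ x) (f : x ~ v) → u ≢ v → ¬ u ~ v → IsGeodesic G (e ◅ f ◅ ε)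
  cherry-isGeodesic {u} {v} e f u≢v u≁v = path , (e ◅ f ◅ ε , path , refl) , λ q _ → 2≤ q
    where
    path : IsPath G (e ◅ f ◅ ε)
    path = cherry-isPath e f u≢v
    2≤ : (q : Walk G u v) → 2 ≤ walkLength G q
    2≤ ε            = contradiction refl u≢v
    2≤ (u~v ◅ ε)    = contradiction u~v u≁v
    2≤ (_ ◅ _ ◅ _)  = s≤s (s≤s z≤n)

  -- A two-step walk between distinct non-adjacent ends is a geodesic, and `w` would be its middle.
  generalPosition⇒¬cherry : ∀ {S u v w} → IsGeneralPosition G S → u ∈ S → v ∈ S → w ∈ S →
    u ≢ v → ¬ u ~ v → ¬ (u ~ w × w ~ v)
  generalPosition⇒¬cherry (_ , gp) u∈S v∈S w∈S u≢v u≁v (e , f) =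
    gp u∈S v∈S w∈S u≢v (~⇒≢ e) (≢-sym (~⇒≢ f)) (e ◅ f ◅ ε) (cherry-isGeodesic e f u≢v u≁v)
       (there (here refl))

  -- At `u = v` the right disjunct just asks for a neighbour, so equal vertices of the Kneser graph
  -- need no separate case.
  Diameter≤2 : Set
  Diameter≤2 = ∀ u v → u ~ v ⊎ (∃[ x ] u ~ x × x ~ v)

  -- Walks of three or more steps are beaten by the diameter and those of at most one step have no
  -- inner vertex, so only the middle of a two-step geodesic is left to `h`.
  diameter≤2⇒generalPosition : ∀ {S} → Diameter≤2 → Unique S →
    (∀ {u v w} → u ∈ S → v ∈ S → w ∈ S → u ~ w → w ~ v → ¬ u ~ v → u ≡ v) →
    IsGeneralPosition G S
  diameter≤2⇒generalPosition {S} diam S! h = S! , gp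
    where
    gp : ∀ {u v w} → u ∈ S → v ∈ S → w ∈ S → u ≢ v → u ≢ w → v ≢ w →
         (p : Walk G u v) → IsGeodesic G p → w ∉ vertices G p
    gp _ _ _ u≢v _ _ ε _ _ = u≢v refl
    gp _ _ _ _ u≢w _ (_ ◅ _) _ (here refl) = u≢w refl
    gp _ _ _ _ _ v≢w (_ ◅ ε) _ (there (here refl)) = v≢w refl
    -- Non-adjacency of `u` and `v` is available to `h`, since an edge would be shorter than this
    -- geodesic.
    gp u∈S v∈S w∈S u≢v _ _ (e ◅ f ◅ ε) (_ , _ , shortest) (there (here refl)) =
      u≢v (h u∈S v∈S w∈S e f λ u~v →
        contradiction (shortest (u~v ◅ ε) (edge-isPath u~v)) λ { (s≤s ()) })
    gp _ _ _ _ _ v≢w (_ ◅ _ ◅ ε) _ (there (there (here refl))) = v≢w refl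
    gp {u} {v} _ _ _ u≢v _ _ (_ ◅ _ ◅ _ ◅ _) (_ , _ , shortest) (there _) with diam u v
    ... | inj₁ u~v =
      contradiction (shortest (u~v ◅ ε) (edge-isPath u~v)) λ { (s≤s ()) }
    ... | inj₂ (x , e , f) =
      contradiction (shortest (e ◅ f ◅ ε) (cherry-isPath e f u≢v)) λ { (s≤s (s≤s ())) }

-- The upper bound in the Kneser graph.

SubsetOfSize-≡ : ∀ {k} {u v : SubsetOfSize n k} → proj₁ u ≡ proj₁ v → u ≡ v
SubsetOfSize-≡ {u = p , d} {.p , e} refl = cong (p ,_) (≡-irrelevant d e)

-- `proj₁` is injective on vertices, so forgetting the size proofs preserves length and uniqueness.
-- A failure of `free` would put `w` in the middle of a two-step geodesic.
upper-bound : {S : List (SubsetOfSize n 2)} → IsGeneralPosition (K₂ n) S → length S ≤ 6 ⊎ length S < n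
upper-bound {n} {S} gp@(S! , _) = subst (λ k → k ≤ 6 ⊎ k < n) (length-map proj₁ S)
  (UpperBound.bound (map proj₁ S) (Unique.map⁺ SubsetOfSize-≡ S!) size free)
  where
  size : ∀ {p} → p ∈ map proj₁ S → ∣ p ∣ ≡ 2
  size p∈ with (_ , e) , _ , refl ← ∈-map⁻ proj₁ p∈ = e

  free : ∀ {u v w} → u ∈ map proj₁ S → v ∈ map proj₁ S → w ∈ map proj₁ S → u ≢ v → Nonempty (u ∩ v) →
         Nonempty (u ∩ w) ⊎ Nonempty (v ∩ w)
  free {u} {v} {w} u∈ v∈ w∈ u≢v u∩v with nonempty? (u ∩ w) | nonempty? (v ∩ w)
  ... | yes u∩w | _       = inj₁ u∩w
  ... | no  _   | yes v∩w = inj₂ v∩w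
  ... | no  u#w | no  v#w
    with u' , u'∈ , refl ← ∈-map⁻ proj₁ u∈ | v' , v'∈ , refl ← ∈-map⁻ proj₁ v∈ | w' , w'∈ , refl ← ∈-map⁻ proj₁ w∈ =
    contradiction (u#w , subst Empty (∩-comm v w) v#w)
      (generalPosition⇒¬cherry (K₂ n) gp u'∈ v'∈ w'∈ (u≢v ∘ cong proj₁) (λ u#v → u#v u∩v))

-- Diameter two and the star.

subsetOfSize⊆ : ∀ k (p : Subset n) → k ≤ ∣ p ∣ → Σ[ q ∈ SubsetOfSize n k ] proj₁ q ⊆ˢ p
subsetOfSize⊆ {n} zero p             _         = (∅ , ∣⊥∣≡0 n) , ⊥⊆
subsetOfSize⊆ (suc k) (outside ∷ p) k≤         with (q , e) , q⊆p ← subsetOfSize⊆ (suc k) p k≤ =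
  (outside ∷ q , e) , s⊆s q⊆p
subsetOfSize⊆ (suc k) (inside ∷ p)  (s≤s k≤)  with (q , e) , q⊆p ← subsetOfSize⊆ k p k≤ =
  (inside ∷ q , cong suc e) , s⊆s q⊆p

nonempty⇒0<∣p∣ : Nonempty p → 0 < ∣ p ∣
nonempty⇒0<∣p∣ (_ , x∈p) = ≤-<-trans z≤n (x∈p⇒∣p-x∣<∣p∣ x∈p)

-- Two intersecting pairs cover at most 3 points, so at least two of the 5 or more points stay free
-- and form a common neighbour.
diameter≤2-K₂ : 5 ≤ n → Diameter≤2 (K₂ n)
diameter≤2-K₂ {n} 5≤n (p , ∣p∣≡2) (q , ∣q∣≡2) with nonempty? (p ∩ q)
... | no  p#q = inj₁ p#q
... | yes p∩q =
  let ∣p∪q∣≤3 : ∣ p ∪ q ∣ ≤ 3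
      ∣p∪q∣≤3 = ≤-pred (begin
        suc ∣ p ∪ q ∣           ≡⟨ +-comm 1 ∣ p ∪ q ∣ ⟩
        ∣ p ∪ q ∣ + 1           ≤⟨ +-monoʳ-≤ ∣ p ∪ q ∣ (nonempty⇒0<∣p∣ p∩q) ⟩
        ∣ p ∪ q ∣ + ∣ p ∩ q ∣   ≡⟨ ∣p∪q∣+∣p∩q∣ p q ⟩
        ∣ p ∣ + ∣ q ∣           ≡⟨ cong₂ _+_ ∣p∣≡2 ∣q∣≡2 ⟩
        4                       ∎)
      2≤∣∁∣ : 2 ≤ ∣ ∁ (p ∪ q) ∣
      2≤∣∁∣ = subst (2 ≤_) (sym (∣∁p∣≡n∸∣p∣ (p ∪ q))) (∸-mono 5≤n ∣p∪q∣≤3)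
      (r , ∣r∣≡2) , r⊆ = subsetOfSize⊆ 2 (∁ (p ∪ q)) 2≤∣∁∣
  in inj₂ ((r , ∣r∣≡2)
    , (λ (x , x∈) → let x∈p , x∈r = x∈p∩q⁻ p r x∈ in x∈∁p⇒x∉p (r⊆ x∈r) (x∈p∪q⁺ (inj₁ x∈p)))
    , (λ (x , x∈) → let x∈r , x∈q = x∈p∩q⁻ r q x∈ in x∈∁p⇒x∉p (r⊆ x∈r) (x∈p∪q⁺ (inj₂ x∈q))))
  where open ≤-Reasoning

starAtZero : ∀ m → List (SubsetOfSize (suc m) 2)
starAtZero m = tabulate λ i → inside ∷ ⁅ i ⁆ , cong suc (∣⁅x⁆∣≡1 i)

-- Any two members share `zero`, so no two are adjacent and the condition on two-step walks is
-- vacuous.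
starAtZero-generalPosition : 4 ≤ m → IsGeneralPosition (K₂ (suc m)) (starAtZero m)
starAtZero-generalPosition {m} 4≤m = diameter≤2⇒generalPosition (K₂ (suc m)) (diameter≤2-K₂ (s≤s 4≤m))
  (Unique.tabulate⁺ λ {i} {j} e → x∈⁅y⁆⇒x≡y j (subst (i ∈ˢ_) (∷-injectiveʳ (cong proj₁ e)) (x∈⁅x⁆ i)))
  λ u∈ _ w∈ u~w _ _ → contradiction (intersect u∈ w∈) u~w
  where
  intersect : ∀ {u w} → u ∈ starAtZero m → w ∈ starAtZero m → Nonempty (proj₁ u ∩ proj₁ w)
  intersect u∈ w∈ with i , refl ← ∈-tabulate⁻ u∈ | j , refl ← ∈-tabulate⁻ w∈ = zero , here

-- Complements and K(4,2).

disjoint⇒∁ : (p q : Subset n) → Empty (p ∩ q) → ∣ p ∣ + ∣ q ∣ ≡ n → q ≡ ∁ p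
disjoint⇒∁ []            []            _   _ = refl
disjoint⇒∁ (inside ∷ p)  (inside ∷ q)  p#q _ = contradiction (zero , here) p#q
disjoint⇒∁ (inside ∷ p)  (outside ∷ q) p#q e =
  cong (outside ∷_) (disjoint⇒∁ p q (drop-∷-Empty p#q) (suc-injective e))
disjoint⇒∁ (outside ∷ p) (inside ∷ q)  p#q e =
  cong (inside ∷_) (disjoint⇒∁ p q (drop-∷-Empty p#q) (suc-injective (trans (sym (+-suc _ _)) e)))
-- Here `e` would give the disjoint tails one more element together than there are positions left.
disjoint⇒∁ (outside ∷ p) (outside ∷ q) p#q e = contradiction (∣p∣≤n (p ∪ q)) (<⇒≱ (≤-reflexive
  (sym (trans (disjoint⇒∣p∪q∣≡∣p∣+∣q∣ p q (drop-∷-Empty p#q)) e))))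

K₂4-complement : (u v : SubsetOfSize 4 2) → Empty (proj₁ u ∩ proj₁ v) → proj₁ v ≡ ∁ (proj₁ u)
K₂4-complement (p , d) (q , e) p#q = disjoint⇒∁ p q p#q (cong₂ _+_ d e)

-- The only neighbour of a pair is its complement, so a walk keeps switching between the same two
-- sets.
K₂4-walk : ∀ {u v w} (p : Walk (K₂ 4) u v) → w ∈ vertices (K₂ 4) p →
           proj₁ w ≡ proj₁ u ⊎ proj₁ w ≡ ∁ (proj₁ u)
K₂4-walk ε (here refl) = inj₁ refl
K₂4-walk (_ ◅ p) (here refl) = inj₁ refl
K₂4-walk {u} {v} (_◅_ {j = x} e p) (there w∈) with K₂4-walk p w∈
... | inj₁ w≡x  = inj₂ (trans w≡x (K₂4-complement u x e))
... | inj₂ w≡∁x = inj₁ (trans w≡∁x (sym (K₂4-complement x u (Graph.~-sym (K₂ 4) {u} {x} e))))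

K₂4-generalPosition : ∀ {S} → Unique S → IsGeneralPosition (K₂ 4) S
K₂4-generalPosition S! = S! , λ _ _ _ u≢v u≢w v≢w p _ w∈p →
  case K₂4-walk p w∈p , K₂4-walk p (end∈vertices (K₂ 4) p) of λ where
    (inj₁ w≡u  , _)         → u≢w (SubsetOfSize-≡ (sym w≡u))
    (inj₂ _    , inj₁ v≡u)  → u≢v (SubsetOfSize-≡ (sym v≡u))
    (inj₂ w≡∁u , inj₂ v≡∁u) → v≢w (SubsetOfSize-≡ (trans v≡∁u (sym w≡∁u)))

-- The edges of a K4 inside a larger ground set.

pad : ∀ m {n k} → SubsetOfSize n k → SubsetOfSize (m + n) k
pad zero    u = u
pad (suc m) u = let p , e = pad m u in outside ∷ p , e

pad-injective : ∀ m {n k} {u v : SubsetOfSize n k} → pad m u ≡ pad m v → u ≡ v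
pad-injective zero    e = e
pad-injective (suc m) e = pad-injective m (SubsetOfSize-≡ (∷-injectiveʳ (cong proj₁ e)))

pad-disjoint : ∀ m {n k} (u v : SubsetOfSize n k) →
  Empty (proj₁ (pad m u) ∩ proj₁ (pad m v)) → Empty (proj₁ u ∩ proj₁ v)
pad-disjoint zero    u v d = d
pad-disjoint (suc m) u v d = pad-disjoint m u v (drop-∷-Empty d)

K4 : ∀ m → List (SubsetOfSize (m + 4) 2)
K4 m = map (pad m) (subsetsOfSize 4 2)

K4-unique : ∀ m → Unique (K4 m)
K4-unique m = Unique.map⁺ (pad-injective m)
  -- Distinctness of the six underlying vectors is decided by evaluation.
  (Unique.map⁻ {f = proj₁} (from-yes (unique? _≟ˢ_ (map proj₁ (subsetsOfSize 4 2)))))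

-- K(4,2) is disconnected, hence the separate case `m = 0`. Beyond it the diameter is at most two,
-- and if `u` and `v` are both disjoint from `w`, each is its complement within the four points.
K4-generalPosition : ∀ m → IsGeneralPosition (K₂ (m + 4)) (K4 m)
K4-generalPosition zero    = K₂4-generalPosition (K4-unique 0)
K4-generalPosition m@(suc _) = diameter≤2⇒generalPosition (K₂ (m + 4)) (diameter≤2-K₂ (s≤s (m≤n+m 4 _)))
  (K4-unique m) same
  where
  same : ∀ {u v w} → u ∈ K4 m → v ∈ K4 m → w ∈ K4 m →
         Empty (proj₁ u ∩ proj₁ w) → Empty (proj₁ w ∩ proj₁ v) → ¬ Empty (proj₁ u ∩ proj₁ v) → u ≡ v
  same u∈ v∈ w∈ u#w w#v _
    with u , _ , refl ← ∈-map⁻ (pad m) u∈ | v , _ , refl ← ∈-map⁻ (pad m) v∈ | w , _ , refl ← ∈-map⁻ (pad m) w∈ =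
    cong (pad m) (SubsetOfSize-≡ (trans
      (K₂4-complement w u (Graph.~-sym (K₂ 4) {u} {w} (pad-disjoint m u w u#w)))
      (sym (K₂4-complement w v (pad-disjoint m w v w#v)))))

-- The two ranges of n.

K₂-gp-small : ∀ m → m + 4 ≤ 6 → IsGpNumber (K₂ (m + 4)) 6
K₂-gp-small m n≤6 = (K4 m , K4-generalPosition m , length-map (pad m) (subsetsOfSize 4 2)) ,
  λ S gp → [ id , (λ ∣S∣<n → ≤-trans (<⇒≤ ∣S∣<n) n≤6) ]′ (upper-bound gp)

K₂-gp-large : ∀ m → 6 ≤ m → IsGpNumber (K₂ (suc m)) m
K₂-gp-large m 6≤m = (starAtZero m , starAtZero-generalPosition (≤-trans (m≤n+m 4 2) 6≤m) , length-tabulate _) ,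
  λ S gp → [ (λ ∣S∣≤6 → ≤-trans ∣S∣≤6 6≤m) , ≤-pred ]′ (upper-bound gp)

theorem2p2 : (n : ℕ) → 4 ≤ n →
    (n ≤ 6 → IsGpNumber (K₂ n) 6) × (7 ≤ n → IsGpNumber (K₂ n) (n ∸ 1))
theorem2p2 n 4≤n =
  subst (λ n → n ≤ 6 → IsGpNumber (K₂ n) 6) (m∸n+n≡m 4≤n) (K₂-gp-small (n ∸ 4)) ,
  -- Matching exposes `n` as a successor, so `n ∸ 1` computes to the size of the star.
  λ { (s≤s 6≤m) → K₂-gp-large _ 6≤m }
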